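{- Let $D$ be a skeletal directed acyclic graph. For any acyclic reorientation $E$ of $D$, the canonical join representation of $E$ in $\mathcal{AR}_D$ is $$E=\bigvee_{\rho\in\delta_\vee(E)}I_\vee(\rho),$$ and the canonical meet representation of $E$ in $\mathcal{AR}_D$ is $$E=\bigwedge_{\rho\in\delta_\wedge(E)}I_\wedge(\rho).$$
   Context: All directed graphs are finite and simple. A reorientation of a directed acyclic graph $D=(V,A)$ is a directed graph with the same underlying undirected graph, encoded by the set of arcs of $D$ that it reverses. $\mathcal{AR}_D$ is the poset of acyclic reorientations of $D$ ordered by inclusion of sets of reversed arcs. The transitive reduction of a directed acyclic graph is obtained by deleting all arcs whose endpoints are connected by a directed path of length at least $2$. A directed graph is a forest if its underlying undirected graph has no cycle. $D$ is vertebrate if the transitive reduction of every induced subgraph of $D$ is a forest; filled if for any directed path $\pi$ in $D$ whose endpoints are joined by an arc of $D$, all arcs joining any two vertices of $\pi$ belong to $D$; skeletal if vertebrate and filled. When $D$ is skeletal, $\mathcal{AR}_D$ is a semidistributive lattice, so canonical join and meet representations exist. A join representation of an element $x$ of a finite lattice $L$ is a subset $J\subseteq L$ with $x=\bigvee J$; it is irredundant if $x\ne\bigvee J'$ for every strict subset $J'\subsetneq J$. Irredundant join representations of $x$ are ordered by $J\le J'$ if for any $y\in J$ there is $y'\in J'$ with $y\le y'$. The canonical join representation of $x$ is the minimal irredundant join representation for this order, when it exists. Canonical meet representations are defined dually. The transitive support of an arc $(u,v)$ of $D$ is the set of vertices appearing along directed paths in $D$ from $u$ to $v$. A rope of $D$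 is a quadruple $(u,v,\nabla,\Delta)$ where $(u,v)\in A$ and $\nabla\sqcup\Delta$ is a partition of the transitive support of $(u,v)$ minus $\{u,v\}$. For an acyclic reorientation $E$ of $D$ and an arc $(u,v)$ of $D$, let $\nabla_{u,v}^E=\{w\in V : (u,w)\in D\setminus E,\ (w,v)\in D\cap E\}$, $\Delta_{u,v}^E=\{w\in V : (u,w)\in D\cap E,\ (w,v)\in D\setminus E\}$, and $\rho_{u,v}^E=(u,v,\nabla_{u,v}^E,\Delta_{u,v}^E)$. Let $\delta_\vee(E)$ (resp. $\delta_\wedge(E)$) be the set of ropes $\rho_{u,v}^E$ for the arcs $(u,v)$ of $D$ that are reversed (resp. not reversed) in the transitive reduction of $E$, i.e. such that $(v,u)$ (resp. $(u,v)$) is an arc of the transitive reduction of $E$. For a rope $\rho=(u,v,\nabla,\Delta)$, let $I_\vee(\rho)$ be the acyclic reorientation of $D$ where an arc $(w,w')$ of $D$ is reversed if and only if $w\in\Delta\cup\{u\}$ and $w'\in\nabla\cup\{v\}$; let $I_\wedge(\rho)$ be the acyclic reorientation of $D$ where an arc $(w,w')$ of $D$ is not reversed if and only if $w\in\nabla\cup\{u\}$ and $w'\in\Delta\cup\{v\}$. -}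

module Defs where

open import Data.Empty using (⊥-elim)
open import Data.Fin.Base using (Fin)
open import Data.Fin.Properties using (_≟_)
open import Data.Fin.Subset using (Subset; _∈_; _∉_; _∩_; _∪_; ⁅_⁆; Empty)
open import Data.Fin.Subset.Properties
  using (_∈?_; x∈p∩q⁺; x∈p∩q⁻; x∈p∪q⁺; x∈p∪q⁻; x∈⁅x⁆; x∈⁅y⁆⇒x≡y; ∪-comm; ∩-comm)
open import Data.List.Base using (_∷_; _∷ʳ_; length)
open import Data.List.Relation.Unary.Linked using (Linked)
open import Data.List.Relation.Unary.Unique.Propositional using (Unique)
open import Data.Nat.Base using (ℕ; _≤_)
open import Data.Product.Base using (∃-syntax; _×_; _,_; proj₁; proj₂)
open import Data.Sum.Base using (_⊎_; inj₁; inj₂)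
open import Data.Vec.Base using (tabulate)
open import Data.Vec.Properties using (lookup∘tabulate; []=⇒lookup; lookup⇒[]=)
open import Function.Base using (_∘_)
open import Function.Bundles using (_⇔_; mk⇔; Equivalence)
open import Level using (0ℓ; _⊔_) renaming (suc to lsuc)
open import Relation.Binary.Bundles using (Poset)
open import Relation.Binary.Core using (Rel; _⇒_)
open import Relation.Binary.Definitions using (Decidable; _Respects_)
open import Relation.Binary.Construct.Closure.ReflexiveTransitive using (Star; ε; _◅_; _◅◅_)
open import Relation.Binary.Construct.Closure.Symmetric using (SymClosure)
open import Relation.Binary.Construct.Closure.Transitive using (TransClosure; [_]; _∷_)
  renaming (_∷ʳ_ to _∷ʳ⁺_)
import Relation.Binary.Construct.Interior.Symmetric as SymInterior
open import Relation.Binary.PropositionalEquality using (_≡_; _≢_; refl; sym; trans; subst)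
import Relation.Binary.Properties.Poset as PosetProperties
open import Relation.Nullary using (¬_; Dec; does; yes; no)
open import Relation.Nullary.Decidable using (_×-dec_; _⊎-dec_; ¬?; dec-true)
open import Relation.Unary using (Pred; _⊂_) renaming (Decidable to Decidable₁)

module _ {c ℓ₁ ℓ₂} (L : Poset c ℓ₁ ℓ₂) where

  private module L = Poset L

  IsJoin : ∀ {ℓ} → Pred L.Carrier ℓ → Pred L.Carrier (c ⊔ ℓ ⊔ ℓ₂)
  IsJoin J x = (∀ y → J y → y L.≤ x) × (∀ z → (∀ y → J y → y L.≤ z) → x L.≤ z)

  -- Subsets of a finite lattice have decidable membership and respect its
  -- equality.
  record IsJoinRepresentation {ℓ} (J : Pred L.Carrier ℓ) (x : L.Carrier)
                              : Set (c ⊔ ℓ ⊔ ℓ₁ ⊔ ℓ₂) where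
    field
      respects  : J Respects L._≈_
      decidable : Decidable₁ J
      isJoin    : IsJoin J x

  record IsIrredundantJoinRepresentation {ℓ} (J : Pred L.Carrier ℓ) (x : L.Carrier)
                                         : Set (c ⊔ lsuc ℓ ⊔ ℓ₁ ⊔ ℓ₂) where
    field
      isJoinRepresentation : IsJoinRepresentation J x
      irredundant          : (J′ : Pred L.Carrier ℓ) → J′ ⊂ J → ¬ IsJoinRepresentation J′ x

  _≼_ : ∀ {ℓ} → Rel (Pred L.Carrier ℓ) (c ⊔ ℓ ⊔ ℓ₂)
  J ≼ J′ = ∀ y → J y → ∃[ y′ ] J′ y′ × y L.≤ y′

  -- ≼ is a partial order on irredundant representations, so the canonical one
  -- is the minimum: it lies below every other.
  record IsCanonicalJoinRepresentation {ℓ} (J : Pred L.Carrier ℓ) (x : L.Carrier)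
                                       : Set (c ⊔ lsuc ℓ ⊔ ℓ₁ ⊔ ℓ₂) where
    field
      isIrredundantJoinRepresentation : IsIrredundantJoinRepresentation J x
      minimum : (J′ : Pred L.Carrier ℓ) → IsIrredundantJoinRepresentation J′ x → J ≼ J′

  -- The subset of L formed by the values of f on S.
  Image : ∀ {i s} {I : Set i} → (I → L.Carrier) → Pred I s → Pred L.Carrier (i ⊔ s ⊔ ℓ₁)
  Image f S x = ∃[ i ] S i × x L.≈ f i

IsCanonicalMeetRepresentation : ∀ {c ℓ₁ ℓ₂ ℓ} (L : Poset c ℓ₁ ℓ₂) →
  Pred (Poset.Carrier L) ℓ → Poset.Carrier L → Set (c ⊔ lsuc ℓ ⊔ ℓ₁ ⊔ ℓ₂)
IsCanonicalMeetRepresentation L =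
  IsCanonicalJoinRepresentation (PosetProperties.≥-poset L)

-- A directed graph on the vertex set Fin n is given by its arc relation.

module _ {n : ℕ} where

  Acyclic : Rel (Fin n) 0ℓ → Set
  Acyclic R = ∀ {x} → ¬ TransClosure R x x

  TransitiveReduction : Rel (Fin n) 0ℓ → Rel (Fin n) 0ℓ
  TransitiveReduction R u v = R u v × ¬ (∃[ w ] R u w × TransClosure R w v)

  -- The vertices outside U are kept, but isolated: this does not affect
  -- cycles.
  Induced : Rel (Fin n) 0ℓ → Subset n → Rel (Fin n) 0ℓ
  Induced R U u v = R u v × u ∈ U × v ∈ U

  Forest : Rel (Fin n) 0ℓ → Set
  Forest R = ∀ x xs → 2 ≤ length xs → Unique (x ∷ xs) →
             ¬ Linked (SymClosure R) (x ∷ xs ∷ʳ x)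

  Vertebrate : Rel (Fin n) 0ℓ → Set
  Vertebrate R = ∀ U → Forest (TransitiveReduction (Induced R U))

  -- The path goes from a to b and visits x strictly before y.  In an acyclic
  -- graph, an arc joining x and y can only be directed from x to y.
  Filled : Rel (Fin n) 0ℓ → Set
  Filled R = ∀ {a x y b} → R a b →
             Star R a x → TransClosure R x y → Star R y b → R x y

  Skeletal : Rel (Fin n) 0ℓ → Set
  Skeletal R = Vertebrate R × Filled R

-- Acyclicity excludes loops and pairs of opposite arcs, so these graphs are
-- simple.
record DAG (n : ℕ) : Set₁ where
  infix 4 _⟶_ _⟶?_
  field
    _⟶_     : Rel (Fin n) 0ℓ
    _⟶?_    : Decidable _⟶_
    acyclic : Acyclic _⟶_

module _ {n : ℕ} (D : DAG n) where

  open DAG D using (_⟶_; _⟶?_)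

  Reorient : Rel (Fin n) 0ℓ → Rel (Fin n) 0ℓ
  Reorient Rev u v = (u ⟶ v × ¬ Rev u v) ⊎ Rev v u

  record AcyclicReorientation : Set₁ where
    field
      Reversed      : Rel (Fin n) 0ℓ
      reversed?     : Decidable Reversed
      reversed⇒arc  : Reversed ⇒ _⟶_
      acyclic       : Acyclic (Reorient Reversed)

    Arc : Rel (Fin n) 0ℓ
    Arc = Reorient Reversed

    arc? : Decidable Arc
    arc? u v = ((u ⟶? v) ×-dec ¬? (reversed? u v)) ⊎-dec reversed? v u

  open AcyclicReorientation

  AR : Poset _ 0ℓ 0ℓ
  AR = SymInterior.poset {R = λ E F → Reversed E ⇒ Reversed F}
         (λ r → r) (λ E⇒F F⇒G r → F⇒G (E⇒F r))

  TransitiveSupport : Fin n → Fin n → Pred (Fin n) 0ℓ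
  TransitiveSupport u v w = Star _⟶_ u w × Star _⟶_ w v

  record Rope : Set where
    field
      u v      : Fin n
      ∇ Δ      : Subset n
      u⟶v      : u ⟶ v
      disjoint : Empty (∇ ∩ Δ)
      covers   : ∀ w → w ∈ ∇ ∪ Δ ⇔ (TransitiveSupport u v w × w ≢ u × w ≢ v)

  comprehension : {P : Pred (Fin n) 0ℓ} → Decidable₁ P → Subset n
  comprehension P? = tabulate (does ∘ P?)

  ∈-comprehension : {P : Pred (Fin n) 0ℓ} (P? : Decidable₁ P) {w : Fin n} →
                    w ∈ comprehension P? ⇔ P w
  ∈-comprehension {P} P? {w} = mk⇔ to from
    where
    to : w ∈ comprehension P? → P w
    to w∈ with P? w | trans (sym (lookup∘tabulate (does ∘ P?) w)) ([]=⇒lookup w∈)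
    ... | yes p | _  = p
    ... | no  _ | ()
    from : P w → w ∈ comprehension P?
    from p = lookup⇒[]= w _ (trans (lookup∘tabulate (does ∘ P?) w) (dec-true (P? w) p))

  -- In these two formulas a reorientation is viewed as a set of arcs: an arc
  -- of D that is not an arc of E is one that E reverses.
  module _ (E : AcyclicReorientation) (u v : Fin n) where

    In∇ InΔ : Pred (Fin n) 0ℓ
    In∇ w = (u ⟶ w × ¬ Arc E u w) × (w ⟶ v × Arc E w v)
    InΔ w = (u ⟶ w × Arc E u w) × (w ⟶ v × ¬ Arc E w v)

    in∇? : Decidable₁ In∇
    in∇? w = ((u ⟶? w) ×-dec ¬? (arc? E u w)) ×-dec ((w ⟶? v) ×-dec arc? E w v)

    inΔ? : Decidable₁ InΔ
    inΔ? w = ((u ⟶? w) ×-dec arc? E u w) ×-dec ((w ⟶? v) ×-dec ¬? (arc? E w v))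

    ∇ᴱ Δᴱ : Subset n
    ∇ᴱ = comprehension in∇?
    Δᴱ = comprehension inΔ?

  δ∨ : AcyclicReorientation → Pred Rope 0ℓ
  δ∨ E ρ = TransitiveReduction (Arc E) v u × ∇ ≡ ∇ᴱ E u v × Δ ≡ Δᴱ E u v
    where open Rope ρ

  δ∧ : AcyclicReorientation → Pred Rope 0ℓ
  δ∧ E ρ = TransitiveReduction (Arc E) u v × ∇ ≡ ∇ᴱ E u v × Δ ≡ Δᴱ E u v
    where open Rope ρ

  private
    ⟶-irrefl : ∀ {x y} → x ⟶ y → x ≢ y
    ⟶-irrefl x⟶y refl = DAG.acyclic D [ x⟶y ]

    Star⇒⁺ : ∀ {x y} → Star _⟶_ x y → x ≢ y → TransClosure _⟶_ x y
    Star⇒⁺ ε        x≢x = ⊥-elim (x≢x refl)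
    Star⇒⁺ (a ◅ as) _   = go a as
      where
      go : ∀ {x y z} → x ⟶ y → Star _⟶_ y z → TransClosure _⟶_ x z
      go a ε        = [ a ]
      go a (b ◅ bs) = a ∷ go b bs

    reverse : ∀ E {x y} → x ⟶ y → ¬ Arc E x y → Arc E y x
    reverse E {x} {y} x⟶y ¬a with reversed? E x y
    ... | yes r = inj₂ r
    ... | no ¬r = ⊥-elim (¬a (inj₁ (x⟶y , ¬r)))

    module _ (filled : Filled _⟶_) (E : AcyclicReorientation) {u v : Fin n} (u⟶v : u ⟶ v)
             (¬uwv : ∀ {w} → Arc E u w → ¬ Arc E w v)
             (¬vwu : ∀ {w} → Arc E v w → ¬ Arc E w u) where

      rope : Rope
      rope = record
        { u = u ; v = v ; ∇ = ∇ᴱ E u v ; Δ = Δᴱ E u v ; u⟶v = u⟶v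
        ; disjoint = λ (w , w∈) → let (w∈∇ , w∈Δ) = x∈p∩q⁻ _ _ w∈ in
            proj₂ (proj₁ (to∇ w∈∇)) (proj₂ (proj₁ (toΔ w∈Δ)))
        ; covers = λ w → mk⇔ to from
        }
        where
        to∇ : ∀ {w} → w ∈ ∇ᴱ E u v → In∇ E u v w
        to∇ = Equivalence.to (∈-comprehension (in∇? E u v))
        toΔ : ∀ {w} → w ∈ Δᴱ E u v → InΔ E u v w
        toΔ = Equivalence.to (∈-comprehension (inΔ? E u v))

        between : ∀ {w} → u ⟶ w → w ⟶ v → TransitiveSupport u v w × w ≢ u × w ≢ v
        between a b = (a ◅ ε , b ◅ ε) , (λ w≡u → ⟶-irrefl a (sym w≡u)) , ⟶-irrefl b

        to : ∀ {w} → w ∈ ∇ᴱ E u v ∪ Δᴱ E u v → TransitiveSupport u v w × w ≢ u × w ≢ v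
        to w∈ with x∈p∪q⁻ _ _ w∈
        ... | inj₁ w∈∇ = let ((a , _) , (b , _)) = to∇ w∈∇ in between a b
        ... | inj₂ w∈Δ = let ((a , _) , (b , _)) = toΔ w∈Δ in between a b

        from : ∀ {w} → TransitiveSupport u v w × w ≢ u × w ≢ v → w ∈ ∇ᴱ E u v ∪ Δᴱ E u v
        from {w} ((p , q) , w≢u , w≢v) = split (arc? E u w) (arc? E w v)
          where
          u⟶w : u ⟶ w
          u⟶w = filled u⟶v ε (Star⇒⁺ p (λ u≡w → w≢u (sym u≡w))) q
          w⟶v : w ⟶ v
          w⟶v = filled u⟶v p (Star⇒⁺ q w≢v) ε
          split : Dec (Arc E u w) → Dec (Arc E w v) → w ∈ ∇ᴱ E u v ∪ Δᴱ E u v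
          split (yes a) (yes b) = ⊥-elim (¬uwv a b)
          split (no ¬a) (no ¬b) = ⊥-elim (¬vwu (reverse E w⟶v ¬b) (reverse E u⟶w ¬a))
          split (no ¬a) (yes b) = x∈p∪q⁺ (inj₁ (Equivalence.from
            (∈-comprehension (in∇? E u v)) ((u⟶w , ¬a) , (w⟶v , b))))
          split (yes a) (no ¬b) = x∈p∪q⁺ (inj₂ (Equivalence.from
            (∈-comprehension (inΔ? E u v)) ((u⟶w , a) , (w⟶v , ¬b))))

  -- When D is filled, every arc reversed (resp. not reversed) in the
  -- transitive reduction of E does give a rope, so δ∨ E and δ∧ E miss none.
  δ∨-complete : Filled _⟶_ → ∀ E {u v} → u ⟶ v → TransitiveReduction (Arc E) v u →
                ∃[ ρ ] δ∨ E ρ × Rope.u ρ ≡ u × Rope.v ρ ≡ v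
  δ∨-complete filled E u⟶v vu@(v→u , ¬path) =
    rope filled E u⟶v (λ a b → acyclic E (v→u ∷ a ∷ [ b ])) (λ a b → ¬path (_ , a , [ b ]))
    , (vu , refl , refl) , refl , refl

  δ∧-complete : Filled _⟶_ → ∀ E {u v} → u ⟶ v → TransitiveReduction (Arc E) u v →
                ∃[ ρ ] δ∧ E ρ × Rope.u ρ ≡ u × Rope.v ρ ≡ v
  δ∧-complete filled E u⟶v uv@(u→v , ¬path) =
    rope filled E u⟶v (λ a b → ¬path (_ , a , [ b ])) (λ a b → acyclic E (u→v ∷ a ∷ [ b ]))
    , (uv , refl , refl) , refl , refl

  I∨-Reversed : Rope → Rel (Fin n) 0ℓ
  I∨-Reversed ρ w w′ = w ⟶ w′ × w ∈ Δ ∪ ⁅ u ⁆ × w′ ∈ ∇ ∪ ⁅ v ⁆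
    where open Rope ρ

  I∧-Reversed : Rope → Rel (Fin n) 0ℓ
  I∧-Reversed ρ w w′ = w ⟶ w′ × ¬ (w ∈ ∇ ∪ ⁅ u ⁆ × w′ ∈ Δ ∪ ⁅ v ⁆)
    where open Rope ρ

  private
    -- No path of I∨ ρ leads from Δ ∪ ⁅ u ⁆ to ∇ ∪ ⁅ v ⁆.
    module _ (ρ : Rope) where
      open Rope ρ

      Safe : Pred (Fin n) 0ℓ
      Safe x = Star _⟶_ u x × x ∉ ∇ ∪ ⁅ v ⁆

      to-v : ∀ {x} → x ∈ ∇ ∪ ⁅ v ⁆ → Star _⟶_ x v
      to-v {x} x∈ with x∈p∪q⁻ ∇ ⁅ v ⁆ x∈
      ... | inj₁ x∈∇ = proj₂ (proj₁ (Equivalence.to (covers x) (x∈p∪q⁺ (inj₁ x∈∇))))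
      ... | inj₂ x∈v with refl ← x∈⁅y⁆⇒x≡y v x∈v = ε

      start : ∀ {x} → x ∈ Δ ∪ ⁅ u ⁆ → Safe x
      start {x} x∈ with x∈p∪q⁻ Δ ⁅ u ⁆ x∈
      ... | inj₁ x∈Δ = proj₁ (proj₁ c) , λ x∈T → bad (x∈p∪q⁻ ∇ ⁅ v ⁆ x∈T)
        where
        c = Equivalence.to (covers x) (x∈p∪q⁺ (inj₂ x∈Δ))
        bad : ¬ (x ∈ ∇ ⊎ x ∈ ⁅ v ⁆)
        bad (inj₁ x∈∇) = disjoint (x , x∈p∩q⁺ (x∈∇ , x∈Δ))
        bad (inj₂ x∈v) = proj₂ (proj₂ c) (x∈⁅y⁆⇒x≡y v x∈v)
      ... | inj₂ x∈u with refl ← x∈⁅y⁆⇒x≡y u x∈u = ε , λ x∈T → bad (x∈p∪q⁻ ∇ ⁅ v ⁆ x∈T)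
        where
        bad : ¬ (u ∈ ∇ ⊎ u ∈ ⁅ v ⁆)
        bad (inj₁ u∈∇) = proj₁ (proj₂ (Equivalence.to (covers u) (x∈p∪q⁺ (inj₁ u∈∇)))) refl
        bad (inj₂ u∈v) = ⟶-irrefl u⟶v (x∈⁅y⁆⇒x≡y v u∈v)

      step : ∀ {x y} → Safe x → Reorient (I∨-Reversed ρ) x y → Safe y
      step (_ , x∉T) (inj₂ (_ , _ , x∈T)) = ⊥-elim (x∉T x∈T)
      step {x} {y} (ux , x∉T) (inj₁ (x⟶y , ¬rev)) =
        ux ◅◅ (x⟶y ◅ ε) , λ y∈T → ¬rev (x⟶y , x∈S y∈T , y∈T)
        where
        x∈S : y ∈ ∇ ∪ ⁅ v ⁆ → x ∈ Δ ∪ ⁅ u ⁆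
        x∈S y∈T with x ≟ u
        ... | yes refl = x∈p∪q⁺ (inj₂ (x∈⁅x⁆ u))
        ... | no x≢u with x∈p∪q⁻ ∇ Δ (Equivalence.from (covers x)
                            ((ux , x⟶y ◅ to-v y∈T) , x≢u ,
                             λ x≡v → x∉T (x∈p∪q⁺ (inj₂ (subst (_∈ ⁅ v ⁆) (sym x≡v) (x∈⁅x⁆ v))))))
        ...   | inj₁ x∈∇ = ⊥-elim (x∉T (x∈p∪q⁺ (inj₁ x∈∇)))
        ...   | inj₂ x∈Δ = x∈p∪q⁺ (inj₁ x∈Δ)

      steps : ∀ {x y} → Safe x → Star (Reorient (I∨-Reversed ρ)) x y → Safe y
      steps s ε        = s
      steps s (a ◅ as) = steps (step s a) as

      scan : ∀ {x y} → TransClosure (Reorient (I∨-Reversed ρ)) x y →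
             TransClosure _⟶_ x y ⊎
             ∃[ a ] ∃[ b ] Star (Reorient (I∨-Reversed ρ)) x a × I∨-Reversed ρ b a ×
                           Star (Reorient (I∨-Reversed ρ)) b y
      scan [ inj₁ (a , _) ]     = inj₁ [ a ]
      scan [ inj₂ r ]           = inj₂ (_ , _ , ε , r , ε)
      scan (inj₁ (a , ¬r) ∷ as) with scan as
      ... | inj₁ p                   = inj₁ (a ∷ p)
      ... | inj₂ (_ , _ , p , r , q) = inj₂ (_ , _ , inj₁ (a , ¬r) ◅ p , r , q)
      scan (inj₂ r ∷ as)        = inj₂ (_ , _ , ε , r , star as)
        where
        star : ∀ {x y} → TransClosure (Reorient (I∨-Reversed ρ)) x y →
               Star (Reorient (I∨-Reversed ρ)) x y
        star [ a ]    = a ◅ ε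
        star (a ∷ as) = a ◅ star as

      I∨-acyclic : Acyclic (Reorient (I∨-Reversed ρ))
      I∨-acyclic cycle with scan cycle
      ... | inj₁ p = DAG.acyclic D p
      ... | inj₂ (a , b , p , (_ , b∈S , a∈T) , q) = proj₂ (steps (start b∈S) (q ◅◅ p)) a∈T

    swap : Rope → Rope
    swap ρ = record
      { u = u ; v = v ; ∇ = Δ ; Δ = ∇ ; u⟶v = u⟶v
      ; disjoint = subst Empty (∩-comm ∇ Δ) disjoint
      ; covers   = λ w → subst (λ X → w ∈ X ⇔ (TransitiveSupport u v w × w ≢ u × w ≢ v))
                               (∪-comm ∇ Δ) (covers w)
      }
      where open Rope ρ

    -- I∧ ρ is obtained from I∨ (swap ρ) by reversing all arcs.
    module _ (ρ : Rope) where
      open Rope ρ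

      opposite : ∀ {x y} → Reorient (I∧-Reversed ρ) x y → Reorient (I∨-Reversed (swap ρ)) y x
      opposite (inj₂ (y⟶x , ¬m)) = inj₁ (y⟶x , λ (_ , m) → ¬m m)
      opposite {x} {y} (inj₁ (x⟶y , ¬r))
        with (x ∈? (∇ ∪ ⁅ u ⁆)) ×-dec (y ∈? (Δ ∪ ⁅ v ⁆))
      ... | yes m = inj₂ (x⟶y , m)
      ... | no ¬m = ⊥-elim (¬r (x⟶y , ¬m))

      opposite⁺ : ∀ {x y} → TransClosure (Reorient (I∧-Reversed ρ)) x y →
                  TransClosure (Reorient (I∨-Reversed (swap ρ))) y x
      opposite⁺ [ a ]    = [ opposite a ]
      opposite⁺ (a ∷ as) = opposite⁺ as ∷ʳ⁺ opposite a

      I∧-acyclic : Acyclic (Reorient (I∧-Reversed ρ))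
      I∧-acyclic = I∨-acyclic (swap ρ) ∘ opposite⁺

  I∨ : Rope → AcyclicReorientation
  I∨ ρ = record
    { Reversed     = I∨-Reversed ρ
    ; reversed?    = λ w w′ → (w ⟶? w′) ×-dec ((w ∈? (Δ ∪ ⁅ u ⁆)) ×-dec (w′ ∈? (∇ ∪ ⁅ v ⁆)))
    ; reversed⇒arc = proj₁
    ; acyclic      = I∨-acyclic ρ
    }
    where open Rope ρ

  I∧ : Rope → AcyclicReorientation
  I∧ ρ = record
    { Reversed     = I∧-Reversed ρ
    ; reversed?    = λ w w′ → (w ⟶? w′) ×-dec
                              ¬? ((w ∈? (∇ ∪ ⁅ u ⁆)) ×-dec (w′ ∈? (Δ ∪ ⁅ v ⁆)))
    ; reversed⇒arc = proj₁
    ; acyclic      = I∧-acyclic ρ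
    }
    where open Rope ρ

{-# OPTIONS --safe #-}
module Submission where

-- Let v → u be an arc of the transitive reduction of E that is reversed, with rope ρ.
-- A reorientation F ≤ E reverses (u,v) if and only if I∨ ρ ≤ F, and E remains acyclic
-- when (u,v) alone is restored.  Hence every set with join E has an element above
-- I∨ ρ, and since (u,v) is the only one of these arcs that I∨ ρ reverses, the I∨ ρ
-- form an antichain.
--
-- That their join is E uses that D is skeletal.  Let (a,b) be reversed in E, and let U
-- be the set of vertices on paths of E from b to a.  If a ⟶ p ⟶ b with p in U, then
-- (a,b) is reversed as soon as (a,p) and (p,b) are.  Otherwise (a,b) is an edge of the
-- forest given by the transitive reduction of D on U, and some arc c → c′ of a path from
-- b to a in the transitive reduction of E has to cross it, so c′ ⇒ a ⟶ b ⇒ c in D; then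
-- I∨ ρ reverses (a,b), where ρ is the rope of (c′,c).
--
-- The meet statement is the join statement for the reorientation opposite to E.

open import Defs
open import Data.Bool.Base using (T)
open import Data.Bool.Properties using (T?)
open import Data.Empty using (⊥-elim)
open import Data.Fin.Base using (Fin; combine; remQuot)
open import Data.Fin.Induction using (spo-wellFounded; spo-noetherian)
open import Data.Fin.Properties using (_≟_; any?; all?; remQuot-combine)
open import Data.Fin.Subset using (Subset; Empty; Nonempty; _∈_; _⊆_; _∪_; ⁅_⁆)
open import Data.Fin.Subset.Properties
  using (_∈?_; anySubset?; nonempty?; x∈p∪q⁺; x∈p∪q⁻; x∈⁅x⁆; x∈⁅y⁆⇒x≡y;
         ∪-comm; ∩-comm; ⊆-antisym)
open import Data.List.Base using ([]; _∷_; _∷ʳ_)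
open import Data.List.Membership.Propositional using () renaming (_∈_ to _∈ₗ_)
open import Data.List.Relation.Unary.All using ([]; _∷_)
open import Data.List.Relation.Unary.All.Properties using (¬Any⇒All¬)
open import Data.List.Relation.Unary.AllPairs using ([]; _∷_)
open import Data.List.Relation.Unary.Any using (here; there) renaming (any? to anyₗ?)
open import Data.List.Relation.Unary.Linked as Linked using (Linked; [-]; _∷_)
open import Data.List.Relation.Unary.Unique.Propositional using (Unique)
open import Data.Nat.Base using (ℕ; _*_; s≤s; z≤n)
open import Data.Product.Base using (Σ-syntax; ∃-syntax; _×_; _,_; proj₁; proj₂; uncurry)
open import Data.Sum.Base using (_⊎_; inj₁; inj₂)
open import Data.Vec.Base using (lookup; tabulate)
open import Data.Vec.Properties using (lookup∘tabulate)
open import Function.Base using (_∘_; flip)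
open import Function.Bundles using (_⇔_; module Equivalence)
open import Induction.WellFounded using (WellFounded; Acc; acc)
open import Level using (0ℓ)
open import Relation.Binary.Bundles using (Poset)
open import Relation.Binary.Core using (Rel; _⇒_)
open import Relation.Binary.Definitions using (Decidable; _Respects_)
import Relation.Binary.Construct.Closure.Equivalence as EqClosure
open import Relation.Binary.Construct.Closure.ReflexiveTransitive as Star
  using (Star; ε; _◅_; _◅◅_)
open import Relation.Binary.Construct.Closure.Symmetric using (SymClosure; fwd; bwd)
open import Relation.Binary.Construct.Closure.Transitive as Plus
  using (TransClosure; [_]; _∷_; _++_)
import Relation.Binary.Construct.Interior.Symmetric as SymInterior
import Relation.Binary.Properties.Poset as PosetProperties
open import Relation.Binary.PropositionalEquality
  using (_≡_; _≢_; refl; sym; trans; subst; cong; cong₂; isEquivalence; resp₂)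
open import Relation.Binary.Structures using (IsStrictPartialOrder)
open import Relation.Nullary using (¬_; Dec; yes; no)
open import Relation.Nullary.Decidable
  using (_×-dec_; _⊎-dec_; _→-dec_; ¬?; map′; ⌊_⌋; toWitness; fromWitness; decidable-stable)
open import Relation.Unary using (Pred) renaming (Decidable to Decidable₁)

-- Paths in a relation.

module _ {n : ℕ} {R : Rel (Fin n) 0ℓ} where

  infixr 5 _◅⁺_ _⁺◅◅_ _▻⁺_

  _◅⁺_ : ∀ {x y z} → R x y → Star R y z → TransClosure R x z
  r ◅⁺ ε        = [ r ]
  r ◅⁺ (s ◅ ss) = r ∷ (s ◅⁺ ss)

  _⁺◅◅_ : ∀ {x y z} → TransClosure R x y → Star R y z → TransClosure R x z
  [ r ]    ⁺◅◅ ss = r ◅⁺ ss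
  (r ∷ rs) ⁺◅◅ ss = r ∷ (rs ⁺◅◅ ss)

  _▻⁺_ : ∀ {x y z} → Star R x y → R y z → TransClosure R x z
  ε        ▻⁺ s = [ s ]
  (r ◅ rs) ▻⁺ s = r ∷ (rs ▻⁺ s)

  ⁺⇒⋆ : TransClosure R ⇒ Star R
  ⁺⇒⋆ [ r ]    = r ◅ ε
  ⁺⇒⋆ (r ∷ rs) = r ◅ ⁺⇒⋆ rs

  ⋆⇒⁺ : ∀ {x y} → Star R x y → x ≢ y → TransClosure R x y
  ⋆⇒⁺ ε        x≢x = ⊥-elim (x≢x refl)
  ⋆⇒⁺ (r ◅ rs) _   = r ◅⁺ rs

  ⁺-flip : ∀ {x y} → TransClosure R x y → TransClosure (flip R) y x
  ⁺-flip [ r ]    = [ r ]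
  ⁺-flip (r ∷ rs) = ⁺-flip rs Plus.∷ʳ r

⁺-map : ∀ {n} {R S : Rel (Fin n) 0ℓ} → R ⇒ S → TransClosure R ⇒ TransClosure S
⁺-map f [ r ]    = [ f r ]
⁺-map f (r ∷ rs) = f r ∷ ⁺-map f rs

-- Finite acyclic relations and their transitive reductions.

module _ {n : ℕ} {R : Rel (Fin n) 0ℓ} (acyclic : Acyclic R) where

  ⁺-isStrictPartialOrder : IsStrictPartialOrder _≡_ (TransClosure R)
  ⁺-isStrictPartialOrder = record
    { isEquivalence = isEquivalence
    ; irrefl        = λ { refl → acyclic }
    ; trans         = _++_
    ; <-resp-≈      = resp₂ (TransClosure R)
    }

  ⁺-wellFounded : WellFounded (TransClosure R)
  ⁺-wellFounded = spo-wellFounded ⁺-isStrictPartialOrder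

  ⁺-noetherian : WellFounded (flip (TransClosure R))
  ⁺-noetherian = spo-noetherian ⁺-isStrictPartialOrder

  module _ (R? : Decidable R) where

    ⁺-dec : Decidable (TransClosure R)
    ⁺-dec x y = from x (⁺-noetherian x)
      where
      from : ∀ x → Acc (flip (TransClosure R)) x → Dec (TransClosure R x y)
      from x (acc rec) = map′
        (λ { (inj₁ r) → [ r ] ; (inj₂ (_ , r , rs)) → r ∷ rs })
        (λ { [ r ] → inj₁ r ; (r ∷ rs) → inj₂ (_ , r , rs) })
        (R? x y ⊎-dec any? then)
        where
        then : ∀ w → Dec (R x w × TransClosure R w y)
        then w with R? x w
        ... | no ¬r = no (¬r ∘ proj₁)
        ... | yes r = map′ (r ,_) proj₂ (from w (rec [ r ]))

    ⋆-dec : Decidable (Star R)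
    ⋆-dec x y with x ≟ y
    ... | yes refl = yes ε
    ... | no  x≢y  = map′ ⁺⇒⋆ (λ s → ⋆⇒⁺ s x≢y) (⁺-dec x y)

    shortcut? : ∀ x y → Dec (∃[ w ] R x w × TransClosure R w y)
    shortcut? x y = any? (λ w → R? x w ×-dec ⁺-dec w y)

    transitiveReduction? : Decidable (TransitiveReduction R)
    transitiveReduction? x y = R? x y ×-dec ¬? (shortcut? x y)

    -- A shortcut through `w` replaces the path by two, one ending earlier and one starting later.
    -- Without a shortcut the path is a single arc of the reduction.
    transitiveReduction-generates : TransClosure R ⇒ Star (TransitiveReduction R)
    transitiveReduction-generates = go (⁺-noetherian _) (⁺-wellFounded _)
      where
      go : ∀ {x y} → Acc (flip (TransClosure R)) x → Acc (TransClosure R) y →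
           TransClosure R x y → Star (TransitiveReduction R) x y
      go {x} {y} ax@(acc later) ay@(acc earlier) p with shortcut? x y
      ... | yes (w , r , rs) = go ax (earlier rs) [ r ] ◅◅ go (later [ r ]) ay rs
      go ax ay [ r ]    | no ¬s = (r , ¬s) ◅ ε
      go ax ay (r ∷ rs) | no ¬s = ⊥-elim (¬s (_ , r , rs))

-- Simple paths and bridges of forests.

module _ {n : ℕ} {R : Rel (Fin n) 0ℓ} where

  -- When a vertex is met again, the loop is cut out. The end `y` comes first in the `Unique` list
  -- so that an arc from `y` to `x` closes the path into a cycle as in `Forest`.
  simplePath : ∀ {x y} → Star R x y → x ≢ y →
               ∃[ zs ] Unique (y ∷ x ∷ zs) × Linked R (x ∷ zs ∷ʳ y)
  simplePath         ε                  x≢x = ⊥-elim (x≢x refl)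
  simplePath {x} {y} (_◅_ {j = z} r rs) x≢y with z ≟ y
  ... | yes refl = [] , ((x≢y ∘ sym) ∷ []) ∷ [] ∷ [] , r ∷ [-]
  ... | no  z≢y  with simplePath rs z≢y
  ...   | zs , y∉ ∷ uniq , linked with anyₗ? (x ≟_) (z ∷ zs)
  ...     | no  x∉ = z ∷ zs , ((x≢y ∘ sym) ∷ y∉) ∷ ¬Any⇒All¬ _ x∉ ∷ uniq , r ∷ linked
  ...     | yes x∈ = cut x∈ (y∉ ∷ uniq) linked
    where
    cut : ∀ {w ws} → x ∈ₗ w ∷ ws → Unique (y ∷ w ∷ ws) → Linked R (w ∷ ws ∷ʳ y) →
          ∃[ zs ] Unique (y ∷ x ∷ zs) × Linked R (x ∷ zs ∷ʳ y)
    cut (here refl) uniq linked = _ , uniq , linked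
    cut {ws = _ ∷ _} (there x∈) ((_ ∷ y∉) ∷ _ ∷ uniq) (_ ∷ linked) = cut x∈ (y∉ ∷ uniq) linked

module _ {n : ℕ} {T : Rel (Fin n) 0ℓ} {a b : Fin n} where

  Without : Rel (Fin n) 0ℓ
  Without x y = T x y × ¬ (x ≡ a × y ≡ b)

  -- The walk shortens to a simple path, which the edge `ab` closes into a cycle. A path of length
  -- one would be the excluded edge or an arc from `b` to `a`.
  forest⇒bridge : Forest T → a ≢ b → T a b → ¬ T b a → ¬ Star (SymClosure Without) b a
  forest⇒bridge forest a≢b ab ¬ba walk with simplePath walk (a≢b ∘ sym)
  ... | []     , _    , fwd (ba , _) ∷ _  = ¬ba ba
  ... | []     , _    , bwd (_ , ¬ab) ∷ _ = ¬ab (refl , refl)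
  ... | z ∷ zs , uniq , linked            =
    forest a (b ∷ z ∷ zs) (s≤s (s≤s z≤n)) uniq (fwd ab ∷ Linked.map drop linked)
    where
    drop : SymClosure Without ⇒ SymClosure T
    drop (fwd (t , _)) = fwd t
    drop (bwd (t , _)) = bwd t

  -- Only the part after the last passage is free of the arc; the part before it may contain it.
  splitAtLast : ∀ {x y} → Star T x y → Star Without x y ⊎ (Star T x a × Star Without b y)
  splitAtLast ε = inj₁ ε
  splitAtLast (_◅_ {x} {z} t ts) with splitAtLast ts
  ... | inj₂ (z⇒a , b⇒y) = inj₂ (t ◅ z⇒a , b⇒y)
  ... | inj₁ z⇒y with (x ≟ a) ×-dec (z ≟ b)
  ...   | yes (refl , refl) = inj₂ (ε , z⇒y)
  ...   | no  x≢a           = inj₁ ((t , x≢a) ◅ z⇒y)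

-- Deciding acyclicity.

module _ {n : ℕ} {R : Rel (Fin n) 0ℓ} (R? : Decidable R) where

  private
    -- A nonempty set in which every vertex has a successor is a finite
    -- certificate that R has a cycle.
    HasSuccessors : Subset n → Set
    HasSuccessors S = Nonempty S × (∀ x → x ∈ S → ∃[ y ] R x y × y ∈ S)

    hasSuccessors? : ∀ S → Dec (HasSuccessors S)
    hasSuccessors? S =
      nonempty? S ×-dec
      all? (λ x → (x ∈? S) →-dec any? (λ y → R? x y ×-dec (y ∈? S)))

    sources : ∀ {x y} → TransClosure R x y → Subset n
    sources {x} [ _ ]    = ⁅ x ⁆
    sources {x} (_ ∷ rs) = ⁅ x ⁆ ∪ sources rs

    start∈sources : ∀ {x y} (rs : TransClosure R x y) → x ∈ sources rs
    start∈sources [ _ ]   = x∈⁅x⁆ _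
    start∈sources (_ ∷ _) = x∈p∪q⁺ (inj₁ (x∈⁅x⁆ _))

    successor : ∀ {x y} (rs : TransClosure R x y) → ∀ w → w ∈ sources rs →
                ∃[ w′ ] R w w′ × (w′ ≡ y ⊎ w′ ∈ sources rs)
    successor [ r ] w w∈ with refl ← x∈⁅y⁆⇒x≡y _ w∈ = _ , r , inj₁ refl
    successor (r ∷ rs) w w∈ with x∈p∪q⁻ _ _ w∈
    ... | inj₁ w∈x with refl ← x∈⁅y⁆⇒x≡y _ w∈x = _ , r , inj₂ (x∈p∪q⁺ (inj₂ (start∈sources rs)))
    ... | inj₂ w∈rs with successor rs w w∈rs
    ...   | w′ , r′ , inj₁ w′≡y = w′ , r′ , inj₁ w′≡y
    ...   | w′ , r′ , inj₂ w′∈  = w′ , r′ , inj₂ (x∈p∪q⁺ (inj₂ w′∈))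

  -- In a certificate successors could be followed forever, which acyclicity forbids; conversely,
  -- the sources of the arcs of a cycle form a certificate.
  acyclic? : Dec (Acyclic R)
  acyclic? with anySubset? hasSuccessors?
  ... | yes (S , (x , x∈S) , next) = no λ acyclic → escape acyclic (⁺-noetherian acyclic x) x∈S
    where
    escape : Acyclic R → ∀ {x} → Acc (flip (TransClosure R)) x → ¬ x ∈ S
    escape acyclic (acc rec) x∈S with next _ x∈S
    ... | y , r , y∈S = escape acyclic (rec [ r ]) y∈S
  ... | no ¬S = yes λ cycle →
    ¬S (sources cycle , (_ , start∈sources cycle) , λ w w∈ → close cycle (successor cycle w w∈))
    where
    close : ∀ {x w} (c : TransClosure R x x) → ∃[ w′ ] R w w′ × (w′ ≡ x ⊎ w′ ∈ sources c) →
            ∃[ w′ ] R w w′ × w′ ∈ sources c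
    close c (_ , r , inj₁ refl) = _ , r , start∈sources c
    close c (_ , r , inj₂ w′∈)  = _ , r , w′∈

-- Canonical join representations and order isomorphisms.

module _ {c ℓ₁ ℓ₂} (L : Poset c ℓ₁ ℓ₂) where

  private module L = Poset L

  -- Comparison with all representations also yields irredundancy: if `J′ ⊂ J` is one, each `y` in
  -- `J` lies below an element of `J′`, hence of `J`, and the antichain condition puts `y` in `J′`.
  canonicalJoin : ∀ {ℓ} {J : Pred L.Carrier ℓ} {x} → IsJoinRepresentation L J x →
                  (∀ (J′ : Pred L.Carrier ℓ) → IsJoinRepresentation L J′ x → _≼_ L J J′) →
                  (∀ {y y′} → J y → J y′ → y L.≤ y′ → y L.≈ y′) →
                  IsCanonicalJoinRepresentation L J x
  canonicalJoin rep least antichain = record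
    { isIrredundantJoinRepresentation = record
      { isJoinRepresentation = rep
      ; irredundant = λ J′ (J′⊆J , J⊈J′) rep′ → J⊈J′ λ {y} Jy →
          let (y′ , J′y′ , y≤y′) = least J′ rep′ y Jy in
          IsJoinRepresentation.respects rep′ (L.Eq.sym (antichain Jy (J′⊆J J′y′) y≤y′)) J′y′
      }
    ; minimum = λ J′ irr → least J′ (IsIrredundantJoinRepresentation.isJoinRepresentation irr)
    }

module _ {c ℓ₁ ℓ₂} (L M : Poset c ℓ₁ ℓ₂) where

  private
    module L = Poset L
    module M = Poset M

  module _ (φ : L.Carrier → M.Carrier) (ψ : M.Carrier → L.Carrier)
           (φ-mono : ∀ {x y} → x L.≤ y → φ x M.≤ φ y)
           (ψ-mono : ∀ {x y} → x M.≤ y → ψ x L.≤ ψ y)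
           (ψ∘φ : ∀ x → ψ (φ x) L.≈ x) (φ∘ψ : ∀ y → φ (ψ y) M.≈ y) where

    ψ-cancel-≤ : ∀ {x y} → ψ x L.≤ ψ y → x M.≤ y
    ψ-cancel-≤ {x} {y} le =
      M.trans (M.reflexive (M.Eq.sym (φ∘ψ x))) (M.trans (φ-mono le) (M.reflexive (φ∘ψ y)))

    ψ-cong : ∀ {x y} → x M.≈ y → ψ x L.≈ ψ y
    ψ-cong x≈y = L.antisym (ψ-mono (M.reflexive x≈y)) (ψ-mono (M.reflexive (M.Eq.sym x≈y)))

    -- Serves to exchange joins and meets, with `complement` as both maps between `AR D` and its
    -- opposite order.
    transportJoin : ∀ {ℓ} {J : Pred L.Carrier ℓ} {K : Pred M.Carrier ℓ} →
                    (∀ {y} → K y → J (ψ y)) → (∀ {y} → J (ψ y) → K y) →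
                    ∀ {x y} → x L.≈ ψ y →
                    IsJoinRepresentation L J x → IsJoinRepresentation M K y
    transportJoin K⇒J J⇒K {x} {y} x≈ψy rep = record
      { respects  = λ y≈z Ky → J⇒K (respects (ψ-cong y≈z) (K⇒J Ky))
      ; decidable = λ z → map′ J⇒K K⇒J (decidable (ψ z))
      ; isJoin    =
          (λ z Kz → ψ-cancel-≤ (L.trans (proj₁ isJoin (ψ z) (K⇒J Kz)) (L.reflexive x≈ψy))) ,
          (λ z bound → ψ-cancel-≤ (L.trans (L.reflexive (L.Eq.sym x≈ψy))
             (proj₂ isJoin (ψ z) λ w Jw →
                L.trans (L.reflexive (L.Eq.sym (ψ∘φ w)))
                        (ψ-mono (bound (φ w) (J⇒K (respects (L.Eq.sym (ψ∘φ w)) Jw)))))))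
      }
      where open IsJoinRepresentation rep

-- Arcs of transitive reductions.

module _ {n : ℕ} where

  transitiveReduction-flip : {R S : Rel (Fin n) 0ℓ} →
    (∀ {x y} → R x y → S y x) → (∀ {x y} → S y x → R x y) →
    ∀ {u v} → TransitiveReduction R u v → TransitiveReduction S v u
  transitiveReduction-flip {R} {S} to from (r , ¬s) = to r , λ (w , s , ss) →
    ¬s (rotate (from s) (⁺-flip ss))
    where
    -- Reversal moves the first arc of a shortcut to its end, so the path is regrouped to start with
    -- a single arc again.
    rotate : ∀ {u w v} → R w v → TransClosure (flip S) u w → ∃[ x ] R u x × TransClosure R x v
    rotate r [ s ]    = _ , from s , [ r ]
    rotate r (s ∷ ss) = _ , from s , ⁺-map from ss Plus.∷ʳ r

  -- Any arc before or after the one from `x` to `y` would turn the path into a shortcut from `a` to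
  -- `b`.
  transitiveReduction-unique : {R : Rel (Fin n) 0ℓ} → ∀ {a b x y} →
    TransitiveReduction R a b → Star R a x → R x y → Star R y b → a ≡ x × b ≡ y
  transitiveReduction-unique (_ , ¬s) (r ◅ rs) r′ rs′ = ⊥-elim (¬s (_ , r , (rs ▻⁺ r′) ⁺◅◅ rs′))
  transitiveReduction-unique (_ , ¬s) ε r (r′ ◅ rs′) = ⊥-elim (¬s (_ , r , r′ ◅⁺ rs′))
  transitiveReduction-unique _        ε _ ε          = refl , refl

-- Directions of arcs in acyclic reorientations.

module _ {n : ℕ} (D : DAG n) where

  open DAG D using (_⟶_; _⟶?_)
  open AcyclicReorientation
  open Poset (AR D) using (_≈_) renaming (_≤_ to _⊑_)

  private
    AO = AcyclicReorientation D

  arc-total : (E : AO) → ∀ {x y} → x ⟶ y → Arc E x y ⊎ Arc E y x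
  arc-total E {x} {y} a with reversed? E x y
  ... | yes r = inj₂ (inj₂ r)
  ... | no ¬r = inj₁ (inj₁ (a , ¬r))

  arc⇒adjacent : (E : AO) → ∀ {x y} → Arc E x y → x ⟶ y ⊎ y ⟶ x
  arc⇒adjacent E (inj₁ (a , _)) = inj₁ a
  arc⇒adjacent E (inj₂ r)       = inj₂ (reversed⇒arc E r)

  arc⇒reversed : (E : AO) → ∀ {x y} → x ⟶ y → Arc E y x → Reversed E x y
  arc⇒reversed E a (inj₁ (b , _)) = ⊥-elim (DAG.acyclic D (a ∷ [ b ]))
  arc⇒reversed E a (inj₂ r)       = r

  ¬arc⇒reversed : (E : AO) → ∀ {x y} → x ⟶ y → ¬ Arc E x y → Reversed E x y
  ¬arc⇒reversed E a ¬e with arc-total E a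
  ... | inj₁ e = ⊥-elim (¬e e)
  ... | inj₂ e = arc⇒reversed E a e

  arc⇒¬reversed : (E : AO) → ∀ {x y} → Arc E x y → ¬ Reversed E x y
  arc⇒¬reversed E e r = acyclic E (e ∷ [ inj₂ r ])

  ⋆⇒arc : (E : AO) → ∀ {x y} → x ⟶ y → Star (Arc E) x y → Arc E x y
  ⋆⇒arc E a p with arc-total E a
  ... | inj₁ e = e
  ... | inj₂ e = ⊥-elim (acyclic E (e ◅⁺ p))

  ⋆⇒arc⁻ : (E : AO) → ∀ {x y} → x ⟶ y → Star (Arc E) y x → Arc E y x
  ⋆⇒arc⁻ E a p with arc-total E a
  ... | inj₁ e = ⊥-elim (acyclic E (e ◅⁺ p))
  ... | inj₂ e = e

  ⊑-arc : {E F : AO} → F ⊑ E → ∀ {x y} → x ⟶ y → Arc E x y → Arc F x y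
  ⊑-arc {E} F⊑E a e = inj₁ (a , λ r → arc⇒¬reversed E e (F⊑E r))

  _⊑?_ : (E F : AO) → Dec (E ⊑ F)
  E ⊑? F = map′ (λ h {x} {y} → h x y) (λ h x y → h)
    (all? λ x → all? λ y → reversed? E x y →-dec reversed? F x y)

  -- Finite search over reorientations.

  private
    Coded : Subset (n * n) → Rel (Fin n) 0ℓ
    Coded S x y = x ⟶ y × T (lookup S (combine x y))

    coded? : ∀ S → Decidable (Coded S)
    coded? S x y = (x ⟶? y) ×-dec T? _

    decode : ∀ S → Acyclic (Reorient D (Coded S)) → AO
    decode S acyclic = record
      { Reversed = Coded S ; reversed? = coded? S ; reversed⇒arc = proj₁ ; acyclic = acyclic }

    code : AO → Subset (n * n)
    code E = tabulate (λ i → ⌊ uncurry (reversed? E) (remQuot n i) ⌋)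

    lookup-code : (E : AO) → ∀ x y → lookup (code E) (combine x y) ≡ ⌊ reversed? E x y ⌋
    lookup-code E x y = trans (lookup∘tabulate _ (combine x y))
      (cong (λ (x , y) → ⌊ reversed? E x y ⌋) (remQuot-combine x y))

    code⁺ : (E : AO) → Reversed E ⇒ Coded (code E)
    code⁺ E {x} {y} r = reversed⇒arc E r , subst T (sym (lookup-code E x y)) (fromWitness r)

    code⁻ : (E : AO) → Coded (code E) ⇒ Reversed E
    code⁻ E {x} {y} (_ , t) = toWitness (subst T (lookup-code E x y) t)

    reorient-map : ∀ {P Q : Rel (Fin n) 0ℓ} → P ⇒ Q → Q ⇒ P → Reorient D P ⇒ Reorient D Q
    reorient-map f g (inj₁ (a , ¬p)) = inj₁ (a , ¬p ∘ g)
    reorient-map f g (inj₂ p)        = inj₂ (f p)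

  -- The search runs over the subsets of `Fin (n * n)` that code sets of reversed arcs. Decoding the
  -- code of `E` gives `E` only up to `≈`, which `P` has to respect.
  anyReorientation? : {P : Pred AO 0ℓ} → P Respects _≈_ → Decidable₁ P → Dec (∃[ E ] P E)
  anyReorientation? {P} resp P? = map′
    (λ (S , acyclic , p) → decode S acyclic , p)
    (λ (E , p) → code E ,
       (λ {x} → acyclic E {x} ∘ ⁺-map (reorient-map {Coded (code E)} (code⁻ E) (code⁺ E))) ,
       resp (code⁺ E SymInterior., code⁻ E) p)
    (anySubset? coded)
    where
    coded : ∀ S → Dec (Σ[ a ∈ Acyclic (Reorient D (Coded S)) ] P (decode S a))
    coded S with acyclic? (λ x y → ((x ⟶? y) ×-dec ¬? (coded? S x y)) ⊎-dec coded? S y x)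
    ... | no ¬acyclic = no (¬acyclic ∘ λ (a , _) {x} → a {x})
    ... | yes acyclic = map′ (λ p → (λ {x} → acyclic {x}) , p)
      (λ (_ , p) → resp ((λ r → r) SymInterior., (λ r → r)) p) (P? (decode S acyclic))

  -- Opposite reorientations.

  complement : AO → AO
  complement E = record
    { Reversed     = λ x y → x ⟶ y × ¬ Reversed E x y
    ; reversed?    = λ x y → (x ⟶? y) ×-dec ¬? (reversed? E x y)
    ; reversed⇒arc = proj₁
    ; acyclic      = acyclic E ∘ ⁺-flip ∘ ⁺-map opposite
    }
    where
    opposite : ∀ {x y} → Reorient D (λ x y → x ⟶ y × ¬ Reversed E x y) x y → Arc E y x
    opposite (inj₁ (a , ¬¬r)) = inj₂ (decidable-stable (reversed? E _ _) λ ¬r → ¬¬r (a , ¬r))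
    opposite (inj₂ (a , ¬r))  = inj₁ (a , ¬r)

  complement-antitone : {E F : AO} → E ⊑ F → complement F ⊑ complement E
  complement-antitone E⊑F (a , ¬r) = a , ¬r ∘ E⊑F

  complement-involutive : (E : AO) → complement (complement E) ≈ E
  complement-involutive E =
    (λ (a , ¬r) → decidable-stable (reversed? E _ _) λ ¬r′ → ¬r (a , ¬r′)) SymInterior.,
    (λ r → reversed⇒arc E r , λ (_ , ¬r) → ¬r r)

  complement-arc⁺ : (E : AO) → ∀ {x y} → Arc E x y → Arc (complement E) y x
  complement-arc⁺ E (inj₁ a) = inj₂ a
  complement-arc⁺ E (inj₂ r) = inj₁ (reversed⇒arc E r , λ (_ , ¬r) → ¬r r)

  complement-arc⁻ : (E : AO) → ∀ {x y} → Arc (complement E) y x → Arc E x y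
  complement-arc⁻ E (inj₂ a) = inj₁ a
  complement-arc⁻ E (inj₁ (a , ¬¬r)) =
    inj₂ (decidable-stable (reversed? E _ _) λ ¬r → ¬¬r (a , ¬r))

  -- Restoring one arc of the transitive reduction.

  module _ (E : AO) {u v : Fin n} (u⟶v : u ⟶ v) (cover : TransitiveReduction (Arc E) v u) where

    private
      Rev : Rel (Fin n) 0ℓ
      Rev x y = Reversed E x y × ¬ (x ≡ u × y ≡ v)

      A = Reorient D Rev

      inherit : Without {T = A} {u} {v} ⇒ Arc E
      inherit (inj₂ (r , _) , _) = inj₂ r
      inherit (inj₁ (a , ¬r) , ≢uv) = inj₁ (a , λ r → ¬r (r , ≢uv))

      ¬return : ¬ Star (Without {T = A} {u} {v}) v u
      ¬return ε = DAG.acyclic D [ u⟶v ]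
      ¬return ((inj₁ (v⟶u , _) , _) ◅ ε) = DAG.acyclic D (u⟶v ∷ [ v⟶u ])
      ¬return ((inj₂ (_ , ≢uv) , _) ◅ ε) = ≢uv (refl , refl)
      ¬return (s ◅ s′ ◅ ss) = proj₂ cover (_ , inherit s , inherit s′ ◅⁺ Star.map inherit ss)

      ¬walk : ¬ Star A v u
      ¬walk w with splitAtLast {a = u} {v} w
      ... | inj₁ s       = ¬return s
      ... | inj₂ (_ , s) = ¬return s

      ¬cycle : ∀ {x y} → A x y → ¬ Star A y x
      ¬cycle {x} {y} s ss with (x ≟ u) ×-dec (y ≟ v)
      ... | yes (refl , refl) = ¬walk ss
      ... | no  ≢uv with splitAtLast {a = u} {v} ss
      ...   | inj₁ ss′         = acyclic E (inherit (s , ≢uv) ◅⁺ Star.map inherit ss′)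
      ...   | inj₂ (y⇒u , v⇒x) = ¬walk (Star.map proj₁ v⇒x ◅◅ s ◅ y⇒u)

      A-acyclic : Acyclic A
      A-acyclic [ s ]    = ¬cycle s ε
      A-acyclic (s ∷ ss) = ¬cycle s (⁺⇒⋆ ss)

    -- A cycle would contain a path from v to u, hence one made of arcs of E other
    -- than v → u, which a transitive reduction forbids.
    lowerCover : AO
    lowerCover = record
      { Reversed     = Rev
      ; reversed?    = λ x y → reversed? E x y ×-dec ¬? ((x ≟ u) ×-dec (y ≟ v))
      ; reversed⇒arc = reversed⇒arc E ∘ proj₁
      ; acyclic      = A-acyclic
      }

  -- The reorientation `I∨ ρ` of a rope of `E`.

  module _ (E : AO) {ρ : Rope D} (ρ∈δ : δ∨ D E ρ) where

    open Rope ρ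

    private
      In⇒E : {S : Subset n} {P : Pred (Fin n) 0ℓ} (P? : Decidable₁ P) →
             S ≡ comprehension D P? → ∀ {w} → w ∈ S → P w
      In⇒E P? refl = Equivalence.to (∈-comprehension D P?)

    δ∨-reversed : Reversed E u v
    δ∨-reversed = arc⇒reversed E u⟶v (proj₁ (proj₁ ρ∈δ))

    -- For `w` in `Δ`, `E` does not reverse `u ⟶ w`, and `F` reverses no arc that `E` does not.
    reaches-Δ : {F : AO} → F ⊑ E → ∀ {w} → w ∈ Δ ∪ ⁅ u ⁆ → Star (Arc F) u w
    reaches-Δ {F} F⊑E w∈ with x∈p∪q⁻ Δ ⁅ u ⁆ w∈
    ... | inj₂ w∈u with refl ← x∈⁅y⁆⇒x≡y u w∈u = ε
    ... | inj₁ w∈Δ with (u⟶w , u→w) , _ ← In⇒E (inΔ? D E u v) (proj₂ (proj₂ ρ∈δ)) w∈Δ =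
      ⊑-arc {E} {F} F⊑E u⟶w u→w ◅ ε

    ∇-reaches : {F : AO} → F ⊑ E → ∀ {w} → w ∈ ∇ ∪ ⁅ v ⁆ → Star (Arc F) w v
    ∇-reaches {F} F⊑E w∈ with x∈p∪q⁻ ∇ ⁅ v ⁆ w∈
    ... | inj₂ w∈v with refl ← x∈⁅y⁆⇒x≡y v w∈v = ε
    ... | inj₁ w∈∇ with _ , (w⟶v , w→v) ← In⇒E (in∇? D E u v) (proj₁ (proj₂ ρ∈δ)) w∈∇ =
      ⊑-arc {E} {F} F⊑E w⟶v w→v ◅ ε

    -- For an arc `w ⟶ w′` reversed by `I∨ D ρ`, `F` has a path from `w′` through `v` and `u` to
    -- `w`, so acyclicity forces `F` to reverse it too.
    I∨-least : {F : AO} → F ⊑ E → Reversed F u v → I∨ D ρ ⊑ F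
    I∨-least {F} F⊑E r (w⟶w′ , w∈ , w′∈) =
      arc⇒reversed F w⟶w′
        (⋆⇒arc⁻ F w⟶w′ (∇-reaches {F} F⊑E w′∈ ◅◅ inj₂ r ◅ reaches-Δ {F} F⊑E w∈))

    I∨-reversed : Reversed (I∨ D ρ) u v
    I∨-reversed = u⟶v , x∈p∪q⁺ (inj₂ (x∈⁅x⁆ u)) , x∈p∪q⁺ (inj₂ (x∈⁅x⁆ v))

    I∨⊑E : I∨ D ρ ⊑ E
    I∨⊑E = I∨-least {E} (λ r → r) δ∨-reversed

  I∨-cong : (ρ ρ′ : Rope D) → let open Rope in
            u ρ ≡ u ρ′ → v ρ ≡ v ρ′ → ∇ ρ ≡ ∇ ρ′ → Δ ρ ≡ Δ ρ′ → I∨ D ρ ≈ I∨ D ρ′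
  I∨-cong ρ ρ′ refl refl refl refl = (λ r → r) SymInterior., (λ r → r)

  module _ (E : AO) {ρ ρ′ : Rope D} (ρ∈δ : δ∨ D E ρ) (ρ′∈δ : δ∨ D E ρ′) where

    open Rope

    -- Membership in `δ∨ D E` determines `∇` and `Δ` from the endpoints.
    δ∨-cong : u ρ ≡ u ρ′ → v ρ ≡ v ρ′ → I∨ D ρ ≈ I∨ D ρ′
    δ∨-cong u≡ v≡ = I∨-cong ρ ρ′ u≡ v≡
      (trans (proj₁ (proj₂ ρ∈δ)) (trans (cong₂ (∇ᴱ D E) u≡ v≡) (sym (proj₁ (proj₂ ρ′∈δ)))))
      (trans (proj₂ (proj₂ ρ∈δ)) (trans (cong₂ (Δᴱ D E) u≡ v≡) (sym (proj₂ (proj₂ ρ′∈δ)))))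

    -- The hypothesis gives a path of `E` from `v ρ` to `u ρ` through the arc from `v ρ′` to `u ρ′`.
    -- As `v ρ` and `u ρ` are joined by an arc of the transitive reduction, the two arcs coincide.
    δ∨-reversed-unique : Reversed (I∨ D ρ′) (u ρ) (v ρ) → I∨ D ρ ≈ I∨ D ρ′
    δ∨-reversed-unique (_ , u∈ , v∈) =
      let v≡ , u≡ = transitiveReduction-unique (proj₁ ρ∈δ)
                      (∇-reaches E {ρ′} ρ′∈δ {E} (λ r → r) v∈) (proj₁ (proj₁ ρ′∈δ))
                      (reaches-Δ E {ρ′} ρ′∈δ {E} (λ r → r) u∈)
      in δ∨-cong u≡ v≡

  -- The join over the ropes of `E`.

  module _ (skeletal : Skeletal _⟶_) (E : AO) where

    private
      vertebrate = proj₁ skeletal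
      filled     = proj₂ skeletal

      A = Arc E

      module _ (a b : Fin n) where

        between? : Decidable₁ (λ w → Star A b w × Star A w a)
        between? w = ⋆-dec (acyclic E) (arc? E) b w ×-dec ⋆-dec (acyclic E) (arc? E) w a

        U : Subset n
        U = comprehension D between?

        T′ : Rel (Fin n) 0ℓ
        T′ = TransitiveReduction (Induced _⟶_ U)

        ∈U⁺ : ∀ {w} → Star A b w → Star A w a → w ∈ U
        ∈U⁺ p q = Equivalence.from (∈-comprehension D between?) (p , q)

        ∈U⁻ : ∀ {w} → w ∈ U → Star A b w × Star A w a
        ∈U⁻ = Equivalence.to (∈-comprehension D between?)

        inducedAcyclic : Acyclic (Induced _⟶_ U)
        inducedAcyclic = DAG.acyclic D ∘ ⁺-map proj₁

        expand : ∀ {x y} → x ⟶ y → x ∈ U → y ∈ U → Star T′ x y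
        expand e x∈ y∈ = transitiveReduction-generates inducedAcyclic
          (λ x y → (x ⟶? y) ×-dec ((x ∈? U) ×-dec (y ∈? U))) [ e , x∈ , y∈ ]

    -- The paths in `D` place `a` and `b` in the transitive support of `(u , v)`; those in `E` put
    -- `a` on the side of `Δ ∪ ⁅ u ⁆` and `b` on that of `∇ ∪ ⁅ v ⁆`.
    Crossing : Fin n → Fin n → Set
    Crossing a b = ∃[ u ] ∃[ v ] u ⟶ v × TransitiveReduction A v u ×
                   (Star _⟶_ u a × Star _⟶_ b v) × (Star A u a × Star A b v)

    Intermediate : Fin n → Fin n → Set
    Intermediate a b = ∃[ p ] (a ⟶ p × p ⟶ b) × (Star A b p × Star A p a)

    module _ {a b : Fin n} (a⟶b : a ⟶ b) (b→a : A b a) where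

      private
        Side : Rel (Fin n) 0ℓ
        Side = SymClosure (Without {T = T′ a b} {a} {b})

        -- Follows a path of the transitive reduction of `E` from `b` to `a`. The invariant is that
        -- the current vertex `c` is joined to `b` in the forest without the edge `ab`.
        walk : ∀ {c} → Star (TransitiveReduction A) c a → Star A b c → Star Side b c →
               Crossing a b ⊎ Star Side b a
        walk ε _ s = inj₂ s
        walk {c} (_◅_ {j = c′} t ts) b⇒c s = step (arc⇒adjacent E (proj₁ t))
          where
          c′⇒a : Star A c′ a
          c′⇒a = Star.map proj₁ ts
          b⇒c′ : Star A b c′
          b⇒c′ = b⇒c ◅◅ proj₁ t ◅ ε
          c∈U : c ∈ U a b
          c∈U = ∈U⁺ a b b⇒c (proj₁ t ◅ c′⇒a)
          c′∈U : c′ ∈ U a b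
          c′∈U = ∈U⁺ a b b⇒c′ c′⇒a
          step : c ⟶ c′ ⊎ c′ ⟶ c → Crossing a b ⊎ Star Side b a
          step (inj₁ e) with splitAtLast {a = a} {b} (expand a b e c∈U c′∈U)
          ... | inj₁ c⇒c′       = walk ts b⇒c′ (s ◅◅ Star.map fwd c⇒c′)
          -- Traversing `ab` forwards lands at `b`, so the walk kept so far is dropped and restarted
          -- there.
          ... | inj₂ (_ , b⇒c′ₜ) = walk ts b⇒c′ (Star.map fwd b⇒c′ₜ)
          step (inj₂ e) with splitAtLast {a = a} {b} (expand a b e c′∈U c∈U)
          ... | inj₁ c′⇒c = walk ts b⇒c′ (s ◅◅ EqClosure.symmetric _ (Star.map fwd c′⇒c))
          ... | inj₂ (c′⇒aₜ , b⇒cₜ) = inj₁ (c′ , c , e , t ,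
            (Star.map (proj₁ ∘ proj₁) c′⇒aₜ , Star.map (proj₁ ∘ proj₁ ∘ proj₁) b⇒cₜ) , (c′⇒a , b⇒c))

      -- With no intermediate vertex, ab is an edge of the forest on U.  It separates
      -- a from b there, so a path from b to a in the transitive reduction of E
      -- contains an arc of D that, expanded in this forest, crosses ab backwards.
      intermediate⊎crossing : Intermediate a b ⊎ Crossing a b
      intermediate⊎crossing
        with any? (λ p → ((a ⟶? p) ×-dec (p ⟶? b)) ×-dec between? a b p)
      ... | yes i = inj₁ i
      ... | no ¬i
        with walk (transitiveReduction-generates (acyclic E) (arc? E) [ b→a ]) ε ε
      ...   | inj₁ crossing = inj₂ crossing
      ...   | inj₂ b~a =
        ⊥-elim (forest⇒bridge (vertebrate (U a b)) a≢b ab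
                 (λ ba → DAG.acyclic D (a⟶b ∷ [ proj₁ (proj₁ ba) ])) b~a)
        where
        a≢b : a ≢ b
        a≢b refl = DAG.acyclic D [ a⟶b ]
        -- By filledness, a shortcut from `a` to `b` inside `U` would start at an intermediate
        -- vertex.
        ab : T′ a b a b
        ab = (a⟶b , ∈U⁺ a b (b→a ◅ ε) ε , ∈U⁺ a b ε (b→a ◅ ε)) ,
             λ (p , (a⟶p , _ , p∈U) , p⇒b) →
               ¬i (p , (a⟶p , filled a⟶b (a⟶p ◅ ε) (⁺-map proj₁ p⇒b) ε) , ∈U⁻ a b p∈U)

    -- Filledness supplies the arcs joining `a` and `b` to `u` and `v`. If `a ≢ u`, then `u → a` in
    -- `E`, while `a → v` would close a cycle with `v → u`, so `a` is in `Δ`; likewise `b` is `v` or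
    -- in `∇`.
    crossing⇒I∨-reversed : ∀ {a b} → a ⟶ b → Crossing a b →
                           ∃[ ρ ] δ∨ D E ρ × Reversed (I∨ D ρ) a b
    crossing⇒I∨-reversed {a} {b} a⟶b (u , v , u⟶v , t , (u⇒a , b⇒v) , (u⇒ᴱa , b⇒ᴱv))
      with δ∨-complete D filled E u⟶v t
    ... | ρ , ρ∈δ@(_ , refl , refl) , refl , refl = ρ , ρ∈δ , a⟶b , a∈ , b∈
      where
      a∈ : a ∈ Rope.Δ ρ ∪ ⁅ u ⁆
      a∈ with a ≟ u
      ... | yes refl = x∈p∪q⁺ (inj₂ (x∈⁅x⁆ u))
      ... | no  a≢u  = x∈p∪q⁺ (inj₁ (Equivalence.from (∈-comprehension D (inΔ? D E u v))
        ((u⟶a , ⋆⇒arc E u⟶a u⇒ᴱa) ,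
         (filled u⟶v u⇒a (a⟶b ◅⁺ b⇒v) ε , λ e → acyclic E (e ∷ (proj₁ t ◅⁺ u⇒ᴱa))))))
        where
        u⟶a : u ⟶ a
        u⟶a = filled u⟶v ε (⋆⇒⁺ u⇒a (a≢u ∘ sym)) (a⟶b ◅ b⇒v)
      b∈ : b ∈ Rope.∇ ρ ∪ ⁅ v ⁆
      b∈ with b ≟ v
      ... | yes refl = x∈p∪q⁺ (inj₂ (x∈⁅x⁆ v))
      ... | no  b≢v  = x∈p∪q⁺ (inj₁ (Equivalence.from (∈-comprehension D (in∇? D E u v))
        ((filled u⟶v ε (u⇒a ▻⁺ a⟶b) b⇒v , λ e → acyclic E (e ∷ (b⇒ᴱv ▻⁺ proj₁ t))) ,
         (b⟶v , ⋆⇒arc E b⟶v b⇒ᴱv))))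
        where
        b⟶v : b ⟶ v
        b⟶v = filled u⟶v (u⇒a ◅◅ a⟶b ◅ ε) (⋆⇒⁺ b⇒v b≢v) ε

    -- Induction on the endpoints of the arc: an intermediate `p` makes `F` reverse `(a , p)` and
    -- `(p , b)`, and `a → b` in `F` would then close a cycle.
    I∨-bound : (F : AO) → (∀ ρ → δ∨ D E ρ → I∨ D ρ ⊑ F) → E ⊑ F
    I∨-bound F bound r =
      go (⁺-noetherian (DAG.acyclic D) _) (⁺-wellFounded (DAG.acyclic D) _)
         (reversed⇒arc E r) (inj₂ r)
      where
      go : ∀ {a b} → Acc (flip (TransClosure _⟶_)) a → Acc (TransClosure _⟶_) b →
           a ⟶ b → A b a → Reversed F a b
      go aa@(acc later) ab@(acc earlier) a⟶b b→a with intermediate⊎crossing a⟶b b→a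
      ... | inj₂ crossing =
        let ρ , ρ∈δ , r = crossing⇒I∨-reversed a⟶b crossing in bound ρ ρ∈δ r
      ... | inj₁ (p , (a⟶p , p⟶b) , (b⇒p , p⇒a)) =
        ¬arc⇒reversed F a⟶b λ a→b → acyclic F
          (a→b ∷ inj₂ (go (later [ a⟶p ]) ab p⟶b (⋆⇒arc⁻ E p⟶b b⇒p)) ∷
           [ inj₂ (go aa (earlier [ p⟶b ]) a⟶p (⋆⇒arc⁻ E a⟶p p⇒a)) ])

    -- The canonical join representation.

    private
      J : Pred AO 0ℓ
      J = Image (AR D) (I∨ D) (δ∨ D E)

      -- Endpoints determine `I∨ D ρ` up to `≈`, so a search over pairs of vertices replaces one
      -- over ropes.
      J? : Decidable₁ J
      J? F = map′ to from (any? λ u → any? λ v → at? u v)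
        where
        At : Fin n → Fin n → Set
        At u v = ∃[ ρ ] (δ∨ D E ρ × F ≈ I∨ D ρ) × Rope.u ρ ≡ u × Rope.v ρ ≡ v
        to : (∃[ u ] ∃[ v ] At u v) → J F
        to (_ , _ , ρ , (ρ∈δ , F≈) , _) = ρ , ρ∈δ , F≈
        from : J F → ∃[ u ] ∃[ v ] At u v
        from (ρ , ρ∈δ , F≈) = _ , _ , ρ , (ρ∈δ , F≈) , refl , refl
        at? : ∀ u v → Dec (At u v)
        at? u v with (u ⟶? v) ×-dec transitiveReduction? (acyclic E) (arc? E) v u
        ... | no ¬uv = no λ { (ρ , (ρ∈δ , _) , refl , refl) → ¬uv (Rope.u⟶v ρ , proj₁ ρ∈δ) }
        ... | yes (u⟶v , t) with δ∨-complete D filled E u⟶v t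
        ...   | ρ , ρ∈δ , refl , refl = map′
          (λ F≈ → ρ , (ρ∈δ , F≈) , refl , refl)
          (λ { (ρ′ , (ρ′∈δ , F≈) , u≡ , v≡) →
               Poset.Eq.trans (AR D) F≈ (δ∨-cong E {ρ′} {ρ} ρ′∈δ ρ∈δ u≡ v≡) })
          (SymInterior.decidable _⊑?_ F (I∨ D ρ))

    I∨-joinRepresentation : IsJoinRepresentation (AR D) J E
    I∨-joinRepresentation = record
      { respects  = λ { F≈G (ρ , ρ∈δ , F≈) →
                        ρ , ρ∈δ , Poset.Eq.trans (AR D) (Poset.Eq.sym (AR D) F≈G) F≈ }
      ; decidable = J?
      ; isJoin    =
          (λ { F (ρ , ρ∈δ , F≈) r → I∨⊑E E {ρ} ρ∈δ (SymInterior.lhs≤rhs F≈ r) }) ,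
          (λ F bound → I∨-bound F λ ρ ρ∈δ → bound (I∨ D ρ) (ρ , ρ∈δ , Poset.Eq.refl (AR D)))
      }

    -- If no element of `J′` reversed `(u , v)`, all would lie below `lowerCover`, and so would
    -- their join `E`, which does reverse it.
    I∨-minimum : (J′ : Pred AO 0ℓ) → IsJoinRepresentation (AR D) J′ E → _≼_ (AR D) J J′
    I∨-minimum J′ rep F (ρ , ρ∈δ , F≈)
      with anyReorientation? {λ G → J′ G × Reversed G (Rope.u ρ) (Rope.v ρ)}
             (λ G≈H (J′G , r) → respects G≈H J′G , SymInterior.lhs≤rhs G≈H r)
             (λ G → decidable G ×-dec reversed? G _ _)
      where open IsJoinRepresentation rep
    ... | yes (G , J′G , r) = G , J′G , λ r′ →
            I∨-least E {ρ} ρ∈δ {G} (proj₁ isJoin G J′G) r (SymInterior.lhs≤rhs F≈ r′)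
      where open IsJoinRepresentation rep
    ... | no ¬G =
      ⊥-elim (proj₂ (proj₂ isJoin (lowerCover E u⟶v (proj₁ ρ∈δ)) bound (δ∨-reversed E {ρ} ρ∈δ))
                    (refl , refl))
      where
      open IsJoinRepresentation rep
      open Rope ρ
      bound : ∀ G → J′ G → G ⊑ lowerCover E u⟶v (proj₁ ρ∈δ)
      bound G J′G r = proj₁ isJoin G J′G r , λ { (refl , refl) → ¬G (G , J′G , r) }

    I∨-antichain : ∀ {F G} → J F → J G → F ⊑ G → F ≈ G
    I∨-antichain (ρ , ρ∈δ , F≈) (ρ′ , ρ′∈δ , G≈) F⊑G =
      Eq.trans F≈ (Eq.trans
        (δ∨-reversed-unique E {ρ} {ρ′} ρ∈δ ρ′∈δ
          (SymInterior.lhs≤rhs G≈ (F⊑G (SymInterior.rhs≤lhs F≈ (I∨-reversed E {ρ} ρ∈δ)))))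
        (Eq.sym G≈))
      where open Poset (AR D) using (module Eq)

  -- Duality and the canonical meet representation.

  reflect : Rope D → Rope D
  reflect ρ = record
    { u = u ; v = v ; ∇ = Δ ; Δ = ∇ ; u⟶v = u⟶v
    ; disjoint = subst Empty (∩-comm ∇ Δ) disjoint
    ; covers   = λ w → subst (λ S → w ∈ S ⇔ (TransitiveSupport D u v w × w ≢ u × w ≢ v))
                             (∪-comm ∇ Δ) (covers w)
    }
    where open Rope ρ

  I∧≈complement : ∀ ρ → I∧ D ρ ≈ complement (I∨ D (reflect ρ))
  I∧≈complement ρ =
    (λ (a , ¬m) → a , ¬m ∘ proj₂) SymInterior., (λ (a , ¬m) → a , λ m → ¬m (a , m))

  module _ (E : AO) where

    private
      E′ = complement E

    complement-arc⇒¬arc : ∀ {x y} → Arc E′ x y → ¬ Arc E x y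
    complement-arc⇒¬arc e′ e = acyclic E (complement-arc⁻ E e′ ∷ [ e ])

    ¬arc⇒complement-arc : ∀ {x y} → x ⟶ y → ¬ Arc E x y → Arc E′ x y
    ¬arc⇒complement-arc a ¬e = complement-arc⁺ E (inj₂ (¬arc⇒reversed E a ¬e))

    arc⇒¬complement-arc : ∀ {x y} → Arc E x y → ¬ Arc E′ x y
    arc⇒¬complement-arc e e′ = complement-arc⇒¬arc e′ e

    ¬complement-arc⇒arc : ∀ {x y} → x ⟶ y → ¬ Arc E′ x y → Arc E x y
    ¬complement-arc⇒arc a ¬e′ with arc-total E a
    ... | inj₁ e = e
    ... | inj₂ e = ⊥-elim (¬e′ (complement-arc⁺ E e))

    private
      comprehension-⊆ : {P Q : Pred (Fin n) 0ℓ} (P? : Decidable₁ P) (Q? : Decidable₁ Q) →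
                        (∀ {w} → P w → Q w) → comprehension D P? ⊆ comprehension D Q?
      comprehension-⊆ P? Q? f =
        Equivalence.from (∈-comprehension D Q?) ∘ f ∘ Equivalence.to (∈-comprehension D P?)

    -- On arcs of `D`, being an arc of `E` and not being one are exchanged in the opposite
    -- reorientation.
    ∇-complement : ∀ u v → ∇ᴱ D E u v ≡ Δᴱ D E′ u v
    ∇-complement u v = ⊆-antisym
      (comprehension-⊆ (in∇? D E u v) (inΔ? D E′ u v)
        λ ((a , ¬e) , (b , e)) → (a , ¬arc⇒complement-arc a ¬e) , (b , arc⇒¬complement-arc e))
      (comprehension-⊆ (inΔ? D E′ u v) (in∇? D E u v)
        λ ((a , e′) , (b , ¬e′)) → (a , complement-arc⇒¬arc e′) , (b , ¬complement-arc⇒arc b ¬e′))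

    Δ-complement : ∀ u v → Δᴱ D E u v ≡ ∇ᴱ D E′ u v
    Δ-complement u v = ⊆-antisym
      (comprehension-⊆ (inΔ? D E u v) (in∇? D E′ u v)
        λ ((a , e) , (b , ¬e)) → (a , arc⇒¬complement-arc e) , (b , ¬arc⇒complement-arc b ¬e))
      (comprehension-⊆ (in∇? D E′ u v) (inΔ? D E u v)
        λ ((a , ¬e′) , (b , e′)) → (a , ¬complement-arc⇒arc a ¬e′) , (b , complement-arc⇒¬arc e′))

    δ∧⇒δ∨ : ∀ {ρ} → δ∧ D E ρ → δ∨ D E′ (reflect ρ)
    δ∧⇒δ∨ {ρ} (t , refl , refl) =
      transitiveReduction-flip (complement-arc⁺ E) (complement-arc⁻ E) t ,
      Δ-complement (Rope.u ρ) (Rope.v ρ) , ∇-complement (Rope.u ρ) (Rope.v ρ)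

    δ∨⇒δ∧ : ∀ {ρ} → δ∨ D E′ ρ → δ∧ D E (reflect ρ)
    δ∨⇒δ∧ {ρ} (t , ∇≡ , Δ≡) =
      transitiveReduction-flip (complement-arc⁻ E) (complement-arc⁺ E) t ,
      trans Δ≡ (sym (∇-complement (Rope.u ρ) (Rope.v ρ))) ,
      trans ∇≡ (sym (Δ-complement (Rope.u ρ) (Rope.v ρ)))

  module _ (skeletal : Skeletal _⟶_) (E : AO) where

    private
      open Poset (AR D) using (module Eq)

      J∨ J∧ : Pred AO 0ℓ
      J∨ = Image (AR D) (I∨ D) (δ∨ D (complement E))
      J∧ = Image (AR D) (I∧ D) (δ∧ D E)

      complement-cong : ∀ {F G} → F ≈ G → complement F ≈ complement G
      complement-cong {F} {G} (p SymInterior., q) =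
        complement-antitone {G} {F} q SymInterior., complement-antitone {F} {G} p

      J∧⇒J∨ : ∀ {F} → J∧ F → J∨ (complement F)
      J∧⇒J∨ {F} (ρ , ρ∈δ , F≈) = reflect ρ , δ∧⇒δ∨ E {ρ} ρ∈δ ,
        Eq.trans (complement-cong {F} (Eq.trans F≈ (I∧≈complement ρ))) (complement-involutive _)

      J∨⇒J∧ : ∀ {F} → J∨ (complement F) → J∧ F
      J∨⇒J∧ {F} (ρ , ρ∈δ , F′≈) = reflect ρ , δ∨⇒δ∧ E {ρ} ρ∈δ ,
        Eq.trans (Eq.sym (complement-involutive F))
          (Eq.trans (complement-cong {complement F} F′≈) (Eq.sym (I∧≈complement (reflect ρ))))

      AR≥ = PosetProperties.≥-poset (AR D)

      antitone : ∀ {F G} → F ⊑ G → complement G ⊑ complement F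
      antitone {F} {G} = complement-antitone {F} {G}

    I∨-canonical : IsCanonicalJoinRepresentation (AR D) (Image (AR D) (I∨ D) (δ∨ D E)) E
    I∨-canonical = canonicalJoin (AR D) (I∨-joinRepresentation skeletal E)
      (I∨-minimum skeletal E) (I∨-antichain skeletal E)

    I∧-canonical : IsCanonicalMeetRepresentation (AR D) J∧ E
    I∧-canonical = canonicalJoin AR≥
      (transportJoin (AR D) AR≥ complement complement
        (λ {F} {G} → antitone {F} {G}) (λ {F} {G} → antitone {G} {F})
        complement-involutive complement-involutive J∧⇒J∨ J∨⇒J∧ Eq.refl
        (I∨-joinRepresentation skeletal (complement E)))
      (λ J′ rep F J∧F →
        -- The meet representation `J′` is pulled back to a join representation of `complement E`;
        -- the element found there is complemented back.
        let G , J′G , le = I∨-minimum skeletal (complement E) (J′ ∘ complement)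
              (transportJoin AR≥ (AR D) complement complement
                (λ {F} {G} → antitone {G} {F}) (λ {F} {G} → antitone {F} {G})
                complement-involutive complement-involutive (λ k → k) (λ k → k)
                (Eq.sym (complement-involutive E)) rep)
              (complement F) (J∧⇒J∨ J∧F)
        in complement G , J′G , cancel {F} {G} le)
      λ {F} {G} J∧F J∧G G⊑F → Eq.trans (Eq.sym (complement-involutive F)) (Eq.trans
        (complement-cong (I∨-antichain skeletal (complement E) (J∧⇒J∨ J∧F) (J∧⇒J∨ J∧G)
                           (antitone {G} {F} G⊑F)))
        (complement-involutive G))
      where
      cancel : ∀ {F G} → complement F ⊑ G → complement G ⊑ F
      cancel {F} {G} le r = SymInterior.lhs≤rhs (complement-involutive F) (antitone {complement F} {G} le r)

corollary30 : (n : ℕ) (D : DAG n) → Skeletal (DAG._⟶_ D) →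
    (E : AcyclicReorientation D) →
    IsCanonicalJoinRepresentation (AR D) (Image (AR D) (I∨ D) (δ∨ D E)) E
    × IsCanonicalMeetRepresentation (AR D) (Image (AR D) (I∧ D) (δ∧ D E)) E
corollary30 n D skeletal E = I∨-canonical D skeletal E , I∧-canonical D skeletal E
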